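{- There exist $X\in 2^{\mathbb{N}}$ that are weakly random and do not obey the Strong Law of Large Numbers; that is, there exists a weakly random $X\in 2^{\mathbb{N}}$ for which it is not the case that $\frac{1}{n}\sum_{i=0}^{n-1}X(i)\to\frac12$ as $n\to\infty$.
   Context: $2^{\mathbb{N}}$ is the Cantor space of all total functions $X:\mathbb{N}\to\{0,1\}$ (infinite binary sequences, indexed from $0$). For a finite bitstring $\sigma$, $N_\sigma$ is the set of $X\in 2^{\mathbb{N}}$ having $\sigma$ as an initial segment, and $\mu$ is the unique Borel measure on $2^{\mathbb{N}}$ with $\mu(N_\sigma)=2^{ -|\sigma|}$ for every bitstring $\sigma$. A set $A\subseteq 2^{\mathbb{N}}$ is $\Pi^0_1$ if there is a recursive predicate $R$ such that $X\in A$ if and only if $R(X,n)$ holds for all $n\in\mathbb{N}$. Equivalently, the $\Pi^0_1$ sets are exactly the sets $U_e=\{X\in 2^{\mathbb{N}}:\varphi_e^X(0)\uparrow\}$, $e\in\mathbb{N}$, where $\varphi_e^X(x)$ is the output (if it halts) of the program with Gödel number $e$ on input $x$ with oracle $X$, and $\uparrow$ means "is undefined". A point $X\in 2^{\mathbb{N}}$ is weakly random if it does not belong to any $\Pi^0_1$ set of $\mu$-measure $0$. -}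

module Defs where

open import Level using (0ℓ) renaming (suc to lsuc)
open import Data.Digit using (Bit)
open import Data.Fin.Base using (Fin; toℕ)
open import Data.Integer.Base using (+_)
open import Data.List.Base using (List; length; lookup; foldr; sum; applyUpTo)
open import Data.Nat.Base as ℕ using (ℕ; zero; suc; NonZero)
open import Data.Nat.Properties using (m^n≢0)
open import Data.Product.Base using (Σ-syntax; ∃-syntax; _×_)
open import Data.Rational.Base as ℚ using (ℚ; 0ℚ; ½; _<_; _≤_; _-_; ∣_∣; _/_)
open import Data.Sum.Base using (_⊎_)
open import Data.Vec.Base as Vec using (Vec; []; _∷_)
open import Function.Base using (_∘_)
open import Function.Bundles using (_⇔_)
open import Relation.Binary.PropositionalEquality using (_≡_)
open import Relation.Nullary.Negation using (¬_)
open import Relation.Unary using (Pred; _∈_; _∉_; _⊆_; ⋃)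

Cantor : Set
Cantor = ℕ → Bit

Bitstring : Set
Bitstring = List Bit

N : Bitstring → Pred Cantor 0ℓ
N σ X = ∀ (i : Fin (length σ)) → X (toℕ i) ≡ lookup σ i

------------------------------------------------------------------------
-- Computability relative to an oracle

-- Kleene's partial recursive functions with the oracle as an additional
-- initial function.
data Program : ℕ → Set where
  zero    : Program 0
  succ    : Program 1
  query   : Program 1
  proj    : ∀ {k} → Fin k → Program k
  comp    : ∀ {k m} → Program m → Vec (Program k) m → Program k
  primrec : ∀ {k} → Program k → Program (2 ℕ.+ k) → Program (1 ℕ.+ k)
  min     : ∀ {k} → Program (1 ℕ.+ k) → Program k

-- X ⊢ p ⟨ xs ⟩⇓ y: with oracle X, program p halts on input xs with output y.
data _⊢_⟨_⟩⇓_ (X : Cantor) : ∀ {k} → Program k → Vec ℕ k → ℕ → Set where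
  zero : X ⊢ zero ⟨ [] ⟩⇓ 0

  succ : ∀ {x} → X ⊢ succ ⟨ x ∷ [] ⟩⇓ suc x

  query : ∀ {x} → X ⊢ query ⟨ x ∷ [] ⟩⇓ toℕ (X x)

  proj : ∀ {k} {i : Fin k} {xs} → X ⊢ proj i ⟨ xs ⟩⇓ Vec.lookup xs i

  comp : ∀ {k m} {f : Program m} {gs : Vec (Program k) m} {xs ys z} →
         (∀ i → X ⊢ Vec.lookup gs i ⟨ xs ⟩⇓ Vec.lookup ys i) →
         X ⊢ f ⟨ ys ⟩⇓ z →
         X ⊢ comp f gs ⟨ xs ⟩⇓ z

  primrec-zero : ∀ {k} {f : Program k} {g xs y} →
                 X ⊢ f ⟨ xs ⟩⇓ y →
                 X ⊢ primrec f g ⟨ 0 ∷ xs ⟩⇓ y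

  primrec-suc : ∀ {k} {f : Program k} {g n xs y z} →
                X ⊢ primrec f g ⟨ n ∷ xs ⟩⇓ y →
                X ⊢ g ⟨ n ∷ y ∷ xs ⟩⇓ z →
                X ⊢ primrec f g ⟨ suc n ∷ xs ⟩⇓ z

  min : ∀ {k} {f : Program (1 ℕ.+ k)} {xs y} →
        (∀ i → i ℕ.< y → ∃[ v ] X ⊢ f ⟨ i ∷ xs ⟩⇓ suc v) →
        X ⊢ f ⟨ y ∷ xs ⟩⇓ 0 →
        X ⊢ min f ⟨ xs ⟩⇓ y

-- Some single program computes the characteristic function of R, halting
-- for every oracle X and input n.
Recursive : (Cantor → ℕ → Set) → Set
Recursive R = Σ[ p ∈ Program 1 ] ∀ X n →
  (R X n × X ⊢ p ⟨ n ∷ [] ⟩⇓ 1) ⊎ (¬ R X n × X ⊢ p ⟨ n ∷ [] ⟩⇓ 0)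

Π⁰₁ : Pred Cantor 0ℓ → Set (lsuc 0ℓ)
Π⁰₁ A = Σ[ R ∈ (Cantor → ℕ → Set) ] Recursive R × (∀ X → X ∈ A ⇔ (∀ n → R X n))

------------------------------------------------------------------------
-- Measure

-- 2 ^ (- ∣σ∣)
weight : Bitstring → ℚ
weight σ = (+ 1 / (2 ℕ.^ length σ)) {{m^n≢0 2 (length σ)}}

partialSum : (ℕ → ℚ) → ℕ → ℚ
partialSum f n = foldr ℚ._+_ 0ℚ (applyUpTo f n)

-- The measure with value 2 ^ (- ∣σ∣) on N σ assigns to a Borel set A the
-- number μ(A) = inf { Σᵢ weight (σ i) ∣ A ⊆ ⋃ᵢ N (σ i) } (Carathéodory
-- extension).  As a real number, this infimum is given by its upper
-- Dedekind cut: μ⟨ A ⟩< q says that some cover has total weight less than q,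
-- i.e. has all its partial sums bounded by some r < q.
μ⟨_⟩<_ : Pred Cantor 0ℓ → ℚ → Set
μ⟨ A ⟩< q = Σ[ σ ∈ (ℕ → Bitstring) ]
  A ⊆ ⋃ ℕ (N ∘ σ) ×
  (∃[ r ] r < q × (∀ n → partialSum (weight ∘ σ) n ≤ r))

-- Equality of real numbers is equality of their upper cuts.
μ⟨_⟩≡_ : Pred Cantor 0ℓ → ℚ → Set
μ⟨ A ⟩≡ r = ∀ q → (μ⟨ A ⟩< q) ⇔ (r < q)

WeaklyRandom : Cantor → Set (lsuc 0ℓ)
WeaklyRandom X = ∀ (A : Pred Cantor 0ℓ) → Π⁰₁ A → μ⟨ A ⟩≡ 0ℚ → X ∉ A

------------------------------------------------------------------------
-- The Strong Law of Large Numbers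

average : Cantor → (n : ℕ) .{{_ : NonZero n}} → ℚ
average X n = + sum (applyUpTo (toℕ ∘ X) n) / n

-- The limit is rational, so rational ε suffice.
ObeysSLLN : Cantor → Set
ObeysSLLN X = ∀ ε → 0ℚ < ε →
  ∃[ m ] ∀ n .{{_ : NonZero n}} → m ℕ.≤ n → ∣ average X n - ½ ∣ < ε

{-# OPTIONS --safe #-}
-- X is built as in the Baire category theorem, through finite conditions.  A
-- null set contains no basic open set, so if it is Π⁰₁, witnessed by a program
-- p, then every condition has an extension with a point at which p rejects some
-- input; as this computation reads only finitely many bits of the point, a
-- further extension forces the rejection.  Meeting these dense open sets, one
-- for each of the countably many programs, makes X weakly random.  Padding each
-- condition with a block of ones more than three times as long as the
-- condition keeps infinitely many averages at or above 3/4.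
module Submission where

open import Level using (0ℓ)
open import Axiom.ExcludedMiddle using (ExcludedMiddle)
open import Data.Product.Base using (∃-syntax; _×_)
open import Relation.Nullary.Negation using (¬_)
open import Defs

open import Algebra.Properties.CommutativeSemigroup using (interchange)
open import Algebra.Bundles using (CommutativeMonoid)
open import Data.Digit using (Bit)
open import Data.Empty using (⊥-elim)
open import Data.Fin.Base using (Fin; zero; suc; toℕ; fromℕ<)
open import Data.Fin.Properties using (toℕ<n; toℕ-fromℕ<)
open import Data.Integer.Base as ℤ using (+_)
import Data.Integer.Properties as ℤ
open import Data.List.Base
  using (List; length; []; _∷_; _++_; map; concatMap; cartesianProductWith; allFin; upTo; applyUpTo)
open import Data.List.Membership.Propositional using (_∈_; lose)
open import Data.List.Membership.Propositional.Properties
  using (∈-map⁺; ∈-++⁺ˡ; ∈-++⁺ʳ; ∈-allFin; ∈-upTo⁺; ∈-concatMap⁺; ∈-cartesianProductWith⁺)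
open import Data.List.Relation.Unary.Any using (here; there)
open import Data.Maybe.Base using (Maybe; just; nothing; maybe)
open import Data.Maybe.Relation.Unary.Any as Maybe using (just)
open import Data.Nat.Base as ℕ using (ℕ; zero; suc; z≤n; s≤s; _⊔_; NonZero)
open import Data.Nat.ListAction using (sum)
import Data.Nat.Properties as ℕ
open import Data.Product.Base using (_,_; proj₁; proj₂)
open import Data.Rational.Base as ℚ using (ℚ; 0ℚ; 1ℚ; ½; _/_)
import Data.Rational.Properties as ℚ
import Data.Rational.Unnormalised.Base as ℚᵘ
import Data.Rational.Unnormalised.Properties as ℚᵘ
open import Data.Sum.Base using (_⊎_; inj₁; inj₂)
open import Data.Vec.Base as Vec using (Vec; []; _∷_)
open import Function.Base using (_∘_; case_of_)
open import Function.Bundles using (module Equivalence)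
open import Relation.Binary.Definitions using (tri<; tri≈; tri>)
open import Relation.Binary.PropositionalEquality
  using (_≡_; refl; sym; trans; cong; cong₂; subst; module ≡-Reasoning)
open import Relation.Nullary.Decidable using (yes; no)
open import Relation.Unary using (Pred)

-- Agreement of points on an initial segment

infix 4 _≈[_]_

_≈[_]_ : Cantor → ℕ → Cantor → Set
X ≈[ n ] Y = ∀ i → i ℕ.< n → X i ≡ Y i

≈-trans : ∀ {X Y Z n} → X ≈[ n ] Y → Y ≈[ n ] Z → X ≈[ n ] Z
≈-trans e e′ i i<n = trans (e i i<n) (e′ i i<n)

≈-weaken : ∀ {X Y m n} → m ℕ.≤ n → X ≈[ n ] Y → X ≈[ m ] Y
≈-weaken m≤n e i i<m = e i (ℕ.<-≤-trans i<m m≤n)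

-- Computations

-- `P` contains a basic open neighbourhood of `X`, described by a length.
LocallyAt : Cantor → Pred Cantor 0ℓ → Set
LocallyAt X P = ∃[ n ] (∀ Y → X ≈[ n ] Y → P Y)

module _ {X : Cantor} where

  locally-map : ∀ {P Q} → (∀ {Y} → P Y → Q Y) → LocallyAt X P → LocallyAt X Q
  locally-map f (n , h) = n , λ Y e → f (h Y e)

  locally-× : ∀ {P Q} → LocallyAt X P → LocallyAt X Q → LocallyAt X (λ Y → P Y × Q Y)
  locally-× (m , h) (n , k) = m ⊔ n , λ Y e →
    h Y (≈-weaken (ℕ.m≤m⊔n m n) e) , k Y (≈-weaken (ℕ.m≤n⊔m m n) e)

  locally-∀ : ∀ {m} {P : Fin m → Pred Cantor 0ℓ} →
              (∀ i → LocallyAt X (P i)) → LocallyAt X (λ Y → ∀ i → P i Y)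
  locally-∀ {zero}  h = 0 , λ Y _ ()
  locally-∀ {suc m} h =
    locally-map (λ { (p , q) zero → p ; (p , q) (suc i) → q i })
                (locally-× (h zero) (locally-∀ (h ∘ suc)))

  -- A halting computation is a finitely branching, well-founded derivation that consults the oracle
  -- only at its `query` leaves; a bound for the whole is the maximum of the bounds for the parts.
  use-principle : ∀ {k} {p : Program k} {xs y} →
                  X ⊢ p ⟨ xs ⟩⇓ y → LocallyAt X (λ Y → Y ⊢ p ⟨ xs ⟩⇓ y)
  use-principle zero = 0 , λ _ _ → zero
  use-principle succ = 0 , λ _ _ → succ
  use-principle (query {x}) = suc x , λ Y e →
    subst (λ b → Y ⊢ query ⟨ x ∷ [] ⟩⇓ toℕ b) (sym (e x ℕ.≤-refl)) query
  use-principle proj = 0 , λ _ _ → proj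
  use-principle (comp ds d) =
    locally-map (λ (hs , h) → comp hs h)
      (locally-× (locally-∀ (λ i → use-principle (ds i))) (use-principle d))
  use-principle (primrec-zero d) = locally-map primrec-zero (use-principle d)
  use-principle (primrec-suc d d′) =
    locally-map (λ (h , h′) → primrec-suc h h′)
      (locally-× (use-principle d) (use-principle d′))
  use-principle (min {f = f} {xs} {y} ds d) =
    -- The premises of `min` for the numbers below `y` are re-indexed by `Fin y`, so that the finite
    -- intersection `locally-∀` applies, and then translated back.
    locally-map
      (λ {Y} (hs , h) →
        min (λ i i<y → subst (λ j → ∃[ v ] Y ⊢ f ⟨ j ∷ xs ⟩⇓ suc v)
                             (toℕ-fromℕ< i<y) (hs (fromℕ< i<y)))
            h)
      (locally-×
        (locally-∀ {P = λ i Y → ∃[ v ] Y ⊢ f ⟨ toℕ i ∷ xs ⟩⇓ suc v} (λ i →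
          locally-map (_ ,_) (use-principle (proj₂ (ds (toℕ i) (toℕ<n i))))))
        (use-principle d))

lookup-injective : ∀ {A : Set} {n} {xs ys : Vec A n} →
                   (∀ i → Vec.lookup xs i ≡ Vec.lookup ys i) → xs ≡ ys
lookup-injective {xs = []}     {[]}     e = refl
lookup-injective {xs = x ∷ xs} {y ∷ ys} e =
  cong₂ _∷_ (e zero) (lookup-injective (e ∘ suc))

deterministic : ∀ {X k} {p : Program k} {xs y z} →
                X ⊢ p ⟨ xs ⟩⇓ y → X ⊢ p ⟨ xs ⟩⇓ z → y ≡ z
deterministic zero zero = refl
deterministic succ succ = refl
deterministic query query = refl
deterministic proj proj = refl
deterministic (comp {ys = ys} ds d) (comp {ys = zs} es e)
  with refl ← lookup-injective {xs = ys} {zs} (λ i → deterministic (ds i) (es i)) =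
  deterministic d e
deterministic (primrec-zero d) (primrec-zero e) = deterministic d e
deterministic (primrec-suc d d′) (primrec-suc e e′)
  with refl ← deterministic d e = deterministic d′ e′
deterministic (min {y = y} ds d) (min {y = z} es e) with ℕ.<-cmp y z
... | tri≈ _ y≡z _ = y≡z
-- At the smaller of the two candidates one derivation gives the value 0 and the other a successor.
... | tri< y<z _ _ with () ← deterministic d (proj₂ (es y y<z))
... | tri> _ _ z<y with () ← deterministic (proj₂ (ds z z<y)) e

-- Enumeration of the programs

vectors : ∀ {A : Set} → List A → ∀ m → List (Vec A m)
vectors xs zero    = [] ∷ []
vectors xs (suc m) = cartesianProductWith _∷_ xs (vectors xs m)

initial : ∀ k → List (Program k)
initial 0 = zero ∷ []
initial 1 = succ ∷ query ∷ []
initial _ = []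

recursions : (∀ k → List (Program k)) → ∀ k → List (Program k)
recursions ps zero    = []
recursions ps (suc k) = cartesianProductWith primrec (ps k) (ps (2 ℕ.+ k))

compositions : (∀ k → List (Program k)) → List ℕ → ∀ k → List (Program k)
compositions ps arities k =
  concatMap (λ m → cartesianProductWith comp (ps m) (vectors (ps k) m)) arities

-- The intermediate arity of `comp` is not visible in the type of the composite, so it is bounded by
-- the stage; this keeps each stage a finite list.
programs : ℕ → ∀ k → List (Program k)
programs zero    k = []
programs (suc s) k =
  initial k ++
  map proj (allFin k) ++
  compositions (programs s) (upTo s) k ++
  recursions (programs s) k ++
  map min (programs s (suc k))

-- Asking for all late stages, not just one, lets the stages of several subprograms be merged by a
-- maximum.
Eventually : (ℕ → Set) → Set
Eventually P = ∃[ r ] (∀ {s} → r ℕ.≤ s → P s)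

eventually-× : ∀ {P Q} → Eventually P → Eventually Q → Eventually (λ s → P s × Q s)
eventually-× (m , h) (n , k) =
  m ⊔ n , λ le → h (ℕ.m⊔n≤o⇒m≤o m n le) , k (ℕ.m⊔n≤o⇒n≤o m n le)

eventually-map : ∀ {P Q : ℕ → Set} → (∀ {s} → P s → Q s) → Eventually P → Eventually Q
eventually-map f (r , h) = r , λ le → f (h le)

eventually-suc : ∀ {P Q : ℕ → Set} → (∀ {s} → P s → Q (suc s)) → Eventually P → Eventually Q
eventually-suc f (r , h) = suc r , λ { (s≤s le) → f (h le) }

mutual

  programs-complete : ∀ {k} (p : Program k) → Eventually (λ s → p ∈ programs s k)
  programs-complete zero  = 1 , λ { (s≤s _) → here refl }
  programs-complete succ  = 1 , λ { (s≤s _) → here refl }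
  programs-complete query = 1 , λ { (s≤s _) → there (here refl) }
  programs-complete {k} (proj i) = 1 , λ { (s≤s _) →
    ∈-++⁺ʳ (initial k) (∈-++⁺ˡ (∈-map⁺ proj (∈-allFin i))) }
  programs-complete {k} (comp {m = m} f gs) =
    eventually-suc
      (λ {s} (m<s , f∈ , gs∈) →
        ∈-++⁺ʳ (initial k) (∈-++⁺ʳ (map proj (allFin k)) (∈-++⁺ˡ
          (∈-concatMap⁺ _ (lose (∈-upTo⁺ m<s) (∈-cartesianProductWith⁺ comp f∈ gs∈))))))
      (eventually-× (suc m , λ le → le)
        (eventually-× (programs-complete f) (vectors-complete gs)))
  programs-complete {k} (primrec f g) =
    eventually-suc
      (λ {s} (f∈ , g∈) →
        ∈-++⁺ʳ (initial k) (∈-++⁺ʳ (map proj (allFin k))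
          (∈-++⁺ʳ (compositions (programs s) (upTo s) k) (∈-++⁺ˡ
            (∈-cartesianProductWith⁺ primrec f∈ g∈)))))
      (eventually-× (programs-complete f) (programs-complete g))
  programs-complete {k} (min f) =
    eventually-suc
      (λ {s} f∈ →
        ∈-++⁺ʳ (initial k) (∈-++⁺ʳ (map proj (allFin k))
          (∈-++⁺ʳ (compositions (programs s) (upTo s) k)
            (∈-++⁺ʳ (recursions (programs s) k) (∈-map⁺ min f∈)))))
      (programs-complete f)

  vectors-complete : ∀ {k m} (gs : Vec (Program k) m) →
                     Eventually (λ s → gs ∈ vectors (programs s k) m)
  vectors-complete []       = 0 , λ _ → here refl
  vectors-complete (g ∷ gs) =
    eventually-map (λ (g∈ , gs∈) → ∈-cartesianProductWith⁺ _∷_ g∈ gs∈)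
      (eventually-× (programs-complete g) (vectors-complete gs))

-- Covers of small weight

weight-∷ : ∀ b σ → weight (b ∷ σ) ≡ ½ ℚ.* weight σ
weight-∷ b σ = halve (2 ℕ.^ length σ) {{ℕ.m^n≢0 2 (length σ)}} {{ℕ.m^n≢0 2 (suc (length σ))}}
  where
  halve : ∀ d .{{_ : NonZero d}} .{{_ : NonZero (2 ℕ.* d)}} → + 1 / (2 ℕ.* d) ≡ ½ ℚ.* (+ 1 / d)
  halve (suc e) = ℚ.toℚᵘ-injective (begin
    ℚ.toℚᵘ (+ 1 / (2 ℕ.* suc e))             ≈⟨ ℚ.toℚᵘ-fromℚᵘ (ℚᵘ.½ ℚᵘ.* ℚᵘ.mkℚᵘ (+ 1) e) ⟩
    ℚᵘ.½ ℚᵘ.* ℚᵘ.mkℚᵘ (+ 1) e                ≈⟨ ℚᵘ.*-congˡ {ℚᵘ.½} (ℚ.toℚᵘ-fromℚᵘ (ℚᵘ.mkℚᵘ (+ 1) e)) ⟨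
    ℚ.toℚᵘ ½ ℚᵘ.* ℚ.toℚᵘ (+ 1 / suc e)       ≈⟨ ℚ.toℚᵘ-homo-* ½ (+ 1 / suc e) ⟨
    ℚ.toℚᵘ (½ ℚ.* (+ 1 / suc e))             ∎)
    where open ℚᵘ.≃-Reasoning

½+½ : ∀ p → ½ ℚ.* p ℚ.+ ½ ℚ.* p ≡ p
½+½ p = trans (sym (ℚ.*-distribʳ-+ p ½ ½)) (ℚ.*-identityˡ p)

weight-children : ∀ b σ → weight (b ∷ σ) ℚ.+ weight (b ∷ σ) ≡ weight σ
weight-children b σ = trans (cong₂ ℚ._+_ (weight-∷ b σ) (weight-∷ b σ)) (½+½ (weight σ))

0<weight : ∀ σ → 0ℚ ℚ.< weight σ
0<weight σ = ℚ.positive⁻¹ (weight σ)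
  {{ℚ.normalize-pos 1 (2 ℕ.^ length σ) {{ℕ.m^n≢0 2 (length σ)}}}}

-- `nothing` codes the empty set: a member of a cover that contradicts a bit already read becomes
-- `nothing`, and the cover stays indexed by `ℕ`.
PossibleString : Set
PossibleString = Maybe Bitstring

N? : PossibleString → Pred Cantor 0ℓ
N? m X = Maybe.Any (λ σ → N σ X) m

mass : PossibleString → ℚ
mass = maybe weight 0ℚ

-- N? (b ∂ m) is the set of all Y such that b followed by Y is in N? m.
_∂_ : Bit → PossibleString → PossibleString
b        ∂ nothing             = nothing
b        ∂ just []             = just []
zero     ∂ just (zero ∷ σ)     = just σ
zero     ∂ just (suc zero ∷ σ) = nothing
suc zero ∂ just (zero ∷ σ)     = nothing
suc zero ∂ just (suc zero ∷ σ) = just σ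

∂-∷ : ∀ b σ → b ∂ just (b ∷ σ) ≡ just σ
∂-∷ zero       σ = refl
∂-∷ (suc zero) σ = refl

N?-∂ : ∀ m X → N? m X → N? (X 0 ∂ m) (X ∘ suc)
N?-∂ (just [])      X _         = just λ ()
N?-∂ (just (b ∷ σ)) X (just X∈) =
  subst (λ m → N? m (X ∘ suc))
        (sym (trans (cong (_∂ just (b ∷ σ)) (X∈ zero)) (∂-∷ b σ)))
        (just (X∈ ∘ suc))

-- The two halves of the space have measure ½ each, so a mass is the average of the masses
-- conditional on the first bit.
mass-split : ∀ m → mass m ≡ ½ ℚ.* (mass (zero ∂ m) ℚ.+ mass (suc zero ∂ m))
mass-split nothing               = refl
mass-split (just [])             = refl
mass-split (just (zero ∷ σ))     =
  trans (weight-∷ zero σ) (cong (½ ℚ.*_) (sym (ℚ.+-identityʳ (weight σ))))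
mass-split (just (suc zero ∷ σ)) =
  trans (weight-∷ (suc zero) σ) (cong (½ ℚ.*_) (sym (ℚ.+-identityˡ (weight σ))))

0≤mass : ∀ m → 0ℚ ℚ.≤ mass m
0≤mass nothing  = ℚ.≤-refl
0≤mass (just σ) = ℚ.<⇒≤ (0<weight σ)

-- Partial sums and the total mass of a cover

NonNegative : (ℕ → ℚ) → Set
NonNegative f = ∀ i → 0ℚ ℚ.≤ f i

≤-+-nonNegˡ : ∀ {p q} → 0ℚ ℚ.≤ q → p ℚ.≤ q ℚ.+ p
≤-+-nonNegˡ {p} {q} 0≤q = subst (ℚ._≤ q ℚ.+ p) (ℚ.+-identityˡ p) (ℚ.+-monoˡ-≤ p 0≤q)

partialSum-mono-≤ : ∀ {f} → NonNegative f → ∀ {m n} → m ℕ.≤ n → partialSum f m ℚ.≤ partialSum f n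
partialSum-mono-≤         0≤f {n = zero}  z≤n       = ℚ.≤-refl
partialSum-mono-≤         0≤f {n = suc n} z≤n       =
  ℚ.≤-trans (partialSum-mono-≤ (0≤f ∘ suc) {n = n} z≤n) (≤-+-nonNegˡ (0≤f 0))
partialSum-mono-≤ {f = f} 0≤f             (s≤s m≤n) =
  ℚ.+-monoʳ-≤ (f 0) (partialSum-mono-≤ (0≤f ∘ suc) m≤n)

term≤partialSum : ∀ {f} → NonNegative f → ∀ i → f i ℚ.≤ partialSum f (suc i)
term≤partialSum {f} 0≤f zero    = ℚ.≤-reflexive (sym (ℚ.+-identityʳ (f 0)))
term≤partialSum     0≤f (suc i) =
  ℚ.≤-trans (term≤partialSum (0≤f ∘ suc) i) (≤-+-nonNegˡ (0≤f 0))

partialSum-average : ∀ {f g h : ℕ → ℚ} → (∀ i → f i ≡ ½ ℚ.* (g i ℚ.+ h i)) →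
                     ∀ n → partialSum f n ≡ ½ ℚ.* (partialSum g n ℚ.+ partialSum h n)
partialSum-average e zero = refl
partialSum-average {f} {g} {h} e (suc n) = begin
  f 0 ℚ.+ partialSum (f ∘ suc) n                     ≡⟨ cong₂ ℚ._+_ (e 0) (partialSum-average (e ∘ suc) n) ⟩
  ½ ℚ.* (g 0 ℚ.+ h 0) ℚ.+ ½ ℚ.* (G ℚ.+ H)            ≡⟨ ℚ.*-distribˡ-+ ½ (g 0 ℚ.+ h 0) (G ℚ.+ H) ⟨
  ½ ℚ.* ((g 0 ℚ.+ h 0) ℚ.+ (G ℚ.+ H))                ≡⟨ cong (½ ℚ.*_) (interchange +-commutativeSemigroup (g 0) (h 0) G H) ⟩
  ½ ℚ.* ((g 0 ℚ.+ G) ℚ.+ (h 0 ℚ.+ H))                ∎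
  where
  open ≡-Reasoning
  open CommutativeMonoid ℚ.+-0-commutativeMonoid using () renaming (commutativeSemigroup to +-commutativeSemigroup)
  G H : ℚ
  G = partialSum (g ∘ suc) n
  H = partialSum (h ∘ suc) n

Light : ℚ → (ℕ → PossibleString) → Set
Light r σ = ∀ n → partialSum (mass ∘ σ) n ℚ.≤ r

-- The two conditional masses average to at most `r` and neither is negative, so each is at most
-- twice `r`.
light-∂ : ∀ b σ {r} → Light r σ → Light (r ℚ.+ r) ((b ∂_) ∘ σ)
light-∂ b σ {r} light n = begin
  S b                                       ≤⟨ summand b ⟩
  S zero ℚ.+ S (suc zero)                   ≡⟨ ½+½ _ ⟨
  ½ ℚ.* (S zero ℚ.+ S (suc zero)) ℚ.+ ½ ℚ.* (S zero ℚ.+ S (suc zero))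
    ≡⟨ cong₂ ℚ._+_ split split ⟨
  partialSum (mass ∘ σ) n ℚ.+ partialSum (mass ∘ σ) n ≤⟨ ℚ.+-mono-≤ (light n) (light n) ⟩
  r ℚ.+ r                                   ∎
  where
  open ℚ.≤-Reasoning
  S : Bit → ℚ
  S b = partialSum (mass ∘ (b ∂_) ∘ σ) n
  0≤S : ∀ b → 0ℚ ℚ.≤ S b
  0≤S b = partialSum-mono-≤ (λ i → 0≤mass (b ∂ σ i)) {n = n} z≤n
  split = partialSum-average (mass-split ∘ σ) n
  summand : ∀ b → S b ℚ.≤ S zero ℚ.+ S (suc zero)
  summand zero       = subst (S zero ℚ.≤_) (ℚ.+-comm (S (suc zero)) (S zero)) (≤-+-nonNegˡ (0≤S (suc zero)))
  summand (suc zero) = ≤-+-nonNegˡ (0≤S zero)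

-- A point outside a light cover

infixr 5 _◂_

_◂_ : Bit → Cantor → Cantor
(b ◂ X) zero    = b
(b ◂ X) (suc i) = X i

module _ (em : ExcludedMiddle 0ℓ) where

  light⊎exceeds : ∀ r σ → Light r σ ⊎ (∃[ n ] r ℚ.< partialSum (mass ∘ σ) n)
  light⊎exceeds r σ = case em {∃[ n ] r ℚ.< partialSum (mass ∘ σ) n} of λ where
    (yes exceeds) → inj₂ exceeds
    (no ¬exceeds) → inj₁ λ n → ℚ.≮⇒≥ λ r< → ¬exceeds (n , r<)

  -- The conditional masses for the two bits average to at most `r`, so they cannot both exceed `r`.
  light-child : ∀ {r} σ → Light r σ → ∃[ b ] Light r ((b ∂_) ∘ σ)
  light-child {r} σ light =
    choose (light⊎exceeds r ((zero ∂_) ∘ σ)) (light⊎exceeds r ((suc zero ∂_) ∘ σ))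
    where
    S : Bit → ℕ → ℚ
    S b n = partialSum (mass ∘ (b ∂_) ∘ σ) n

    mono : ∀ b {m n} → m ℕ.≤ n → S b m ℚ.≤ S b n
    mono b = partialSum-mono-≤ (λ i → 0≤mass (b ∂ σ i))

    both : ∀ m n → r ℚ.< S zero m → ¬ r ℚ.< S (suc zero) n
    both m n h h′ = ℚ.<-irrefl refl (begin-strict
      r                                               ≡⟨ ½+½ r ⟨
      ½ ℚ.* r ℚ.+ ½ ℚ.* r                             ≡⟨ ℚ.*-distribˡ-+ ½ r r ⟨
      ½ ℚ.* (r ℚ.+ r)                                 <⟨ ℚ.*-monoʳ-<-pos ½ (ℚ.+-mono-< below below′) ⟩
      ½ ℚ.* (S zero (m ⊔ n) ℚ.+ S (suc zero) (m ⊔ n)) ≡⟨ partialSum-average (mass-split ∘ σ) (m ⊔ n) ⟨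
      partialSum (mass ∘ σ) (m ⊔ n)                   ≤⟨ light (m ⊔ n) ⟩
      r                                               ∎)
      where
      open ℚ.≤-Reasoning
      -- The excesses may occur at different indices; as partial sums increase, both persist at the
      -- maximum.
      below  = ℚ.<-≤-trans h  (mono zero       (ℕ.m≤m⊔n m n))
      below′ = ℚ.<-≤-trans h′ (mono (suc zero) (ℕ.m≤n⊔m m n))

    choose : Light r ((zero ∂_) ∘ σ) ⊎ (∃[ n ] r ℚ.< S zero n) →
             Light r ((suc zero ∂_) ∘ σ) ⊎ (∃[ n ] r ℚ.< S (suc zero) n) →
             ∃[ b ] Light r ((b ∂_) ∘ σ)
    choose (inj₁ l)       _               = zero , l
    choose (inj₂ _)       (inj₁ l)        = suc zero , l
    choose (inj₂ (m , h)) (inj₂ (n , h′)) = ⊥-elim (both m n h h′)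

  -- The mass of the cover relative to every initial segment of the path stays
  -- at most r < 1, whereas it would be at least 1 beyond a string of the cover.
  light-path : ∀ {r} σ → Light r σ → Cantor
  light-path σ light zero    = proj₁ (light-child σ light)
  light-path σ light (suc i) =
    let b , light′ = light-child σ light in light-path ((b ∂_) ∘ σ) light′ i

  -- Induction on the string while the cover changes: a path starting with `b` turns the member
  -- `b ∷ τ` into `τ`, and finally into the empty string, of mass 1.
  light-path-avoids : ∀ {r} → r ℚ.< 1ℚ → ∀ τ σ (light : Light r σ) i →
                      σ i ≡ just τ → ¬ N τ (light-path σ light)
  light-path-avoids r<1 [] σ light i σi≡[] _ = ℚ.<-irrefl refl (begin-strict
    1ℚ                              ≡⟨ cong mass σi≡[] ⟨
    mass (σ i)                      ≤⟨ term≤partialSum (0≤mass ∘ σ) i ⟩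
    partialSum (mass ∘ σ) (suc i)   ≤⟨ light (suc i) ⟩
    _                               <⟨ r<1 ⟩
    1ℚ                              ∎)
    where open ℚ.≤-Reasoning
  light-path-avoids r<1 (b ∷ τ) σ light i σi≡b∷τ Y∈ =
    let c , light′ = light-child σ light in
    light-path-avoids r<1 τ ((c ∂_) ∘ σ) light′ i
      (trans (cong₂ _∂_ (Y∈ zero) σi≡b∷τ) (∂-∷ b τ)) (Y∈ ∘ suc)

  -- Each bit of `f` that is read doubles the bound on the cover and also the weight of the
  -- remaining prefix. After `n` bits the bound is below 1, and a light path completes the point.
  avoid : ∀ n f σ {r} → Light r σ → r ℚ.< weight (applyUpTo f n) →
          ∃[ Y ] (f ≈[ n ] Y × (∀ i → ¬ N? (σ i) Y))
  avoid zero f σ light r<1 = light-path σ light , (λ _ ()) , λ i → avoids i (σ i) refl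
    where
    avoids : ∀ i m → σ i ≡ m → ¬ N? m (light-path σ light)
    avoids i (just τ) e (just Y∈) = light-path-avoids r<1 τ σ light i e Y∈
  avoid (suc n) f σ {r} light r< =
    let Y , f≈Y , Y∉ = avoid n (f ∘ suc) ((f 0 ∂_) ∘ σ) (light-∂ (f 0) σ light)
                         (subst (r ℚ.+ r ℚ.<_) (weight-children (f 0) (applyUpTo (f ∘ suc) n))
                                (ℚ.+-mono-< r< r<))
    in f 0 ◂ Y ,
       (λ { zero _ → refl ; (suc i) (s≤s i<n) → f≈Y i i<n }) ,
       (λ i Y∈ → Y∉ i (N?-∂ (σ i) (f 0 ◂ Y) Y∈))

  null-misses : ∀ {A} → μ⟨ A ⟩≡ 0ℚ → ∀ f n → ∃[ Y ] (f ≈[ n ] Y × ¬ A Y)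
  null-misses null f n =
    let prefix = applyUpTo f n
        -- Nullity is applied with the weight of the prefix itself as the bound, so the cover is too
        -- light to exhaust that basic open set.
        σ , A⊆ , r , r< , bound = Equivalence.from (null (weight prefix)) (0<weight prefix)
        Y , f≈Y , Y∉ = avoid n f (just ∘ σ) bound r<
    in Y , f≈Y , λ Y∈A → let i , Y∈ = A⊆ Y∈A in Y∉ i (just Y∈)

-- Averages

pad : Cantor → ℕ → Cantor
pad f zero    = λ _ → suc zero
pad f (suc n) = f 0 ◂ pad (f ∘ suc) n

pad-≈ : ∀ f n → f ≈[ n ] pad f n
pad-≈ f (suc n) zero    _         = refl
pad-≈ f (suc n) (suc i) (s≤s i<n) = pad-≈ (f ∘ suc) n i i<n

pad-ones : ∀ f n i → pad f n (n ℕ.+ i) ≡ suc zero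
pad-ones f zero    i = refl
pad-ones f (suc n) i = pad-ones (f ∘ suc) n i

sum-ones : ∀ n k {Y : Cantor} → (∀ i → i ℕ.< k → Y (n ℕ.+ i) ≡ suc zero) →
           k ℕ.≤ sum (applyUpTo (toℕ ∘ Y) (n ℕ.+ k))
sum-ones zero    zero        ones = z≤n
sum-ones zero    (suc k) {Y} ones =
  ℕ.+-mono-≤ (ℕ.≤-reflexive (cong toℕ (sym (ones 0 (s≤s z≤n)))))
             (sum-ones zero k (λ i i<k → ones (suc i) (s≤s i<k)))
sum-ones (suc n) k       {Y} ones =
  ℕ.m≤n⇒m≤o+n (toℕ (Y 0)) (sum-ones n k ones)

¼ ¾ : ℚ
¼ = + 1 / 4
¾ = + 3 / 4

¾≤fraction : ∀ s n .{{_ : NonZero n}} → 3 ℕ.* n ℕ.≤ 4 ℕ.* s → ¾ ℚ.≤ + s / n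
¾≤fraction s (suc n) le = ℚ.toℚᵘ-cancel-≤ (begin
  ℚ.toℚᵘ ¾                  ≤⟨ ℚᵘ.*≤* (ℤ.≤-trans (ℤ.+≤+ (subst (3 ℕ.* suc n ℕ.≤_) (ℕ.*-comm 4 s) le))
                                                  (ℤ.≤-reflexive (ℤ.pos-* s 4))) ⟩
  ℚᵘ.mkℚᵘ (+ s) n           ≃⟨ ℚ.toℚᵘ-fromℚᵘ (ℚᵘ.mkℚᵘ (+ s) n) ⟨
  ℚ.toℚᵘ (+ s / suc n)      ∎)
  where open ℚᵘ.≤-Reasoning

¾≤p⇒¼≤∣p-½∣ : ∀ {p} → ¾ ℚ.≤ p → ¼ ℚ.≤ ℚ.∣ p ℚ.- ½ ∣
¾≤p⇒¼≤∣p-½∣ {p} ¾≤p =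
  subst (¼ ℚ.≤_) (sym (ℚ.0≤p⇒∣p∣≡p (ℚ.≤-trans (ℚ.nonNegative⁻¹ ¼) ¼≤))) ¼≤
  where
  ¼≤ : ¼ ℚ.≤ p ℚ.- ½
  ¼≤ = ℚ.+-monoˡ-≤ (ℚ.- ½) ¾≤p

-- For positive `n`, the average is at least ¾, with denominators cleared.
MostlyOnes : ℕ → Pred Cantor 0ℓ
MostlyOnes n Y = 3 ℕ.* n ℕ.≤ 4 ℕ.* sum (applyUpTo (toℕ ∘ Y) n)

often-mostlyOnes⇒¬SLLN : ∀ {X} → (∀ m → ∃[ n ] (m ℕ.< n × MostlyOnes n X)) → ¬ ObeysSLLN X
often-mostlyOnes⇒¬SLLN {X} often obeys =
  -- The tolerance is the gap between ¾ and the limit ½.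
  let m , close = obeys ¼ (ℚ.positive⁻¹ ¼)
      n , m<n , ones = often m
  in far n ones {{ℕ.>-nonZero (ℕ.≤-<-trans z≤n m<n)}}
       (close n {{ℕ.>-nonZero (ℕ.≤-<-trans z≤n m<n)}} (ℕ.<⇒≤ m<n))
  where
  far : ∀ n → MostlyOnes n X → .{{_ : NonZero n}} → ¬ ℚ.∣ average X n ℚ.- ½ ∣ ℚ.< ¼
  far n ones close =
    ℚ.<-irrefl refl (ℚ.<-≤-trans close
      (¾≤p⇒¼≤∣p-½∣ (¾≤fraction (sum (applyUpTo (toℕ ∘ X) n)) n ones)))

-- Conditions

-- `(f , n)` represents the finite string of the first `n` bits of `f`.
Condition : Set
Condition = Cantor × ℕ

infix 4 _∋_ _⊑_

_∋_ : Condition → Pred Cantor 0ℓ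
(f , n) ∋ Y = f ≈[ n ] Y

_⊑_ : Condition → Condition → Set
(f , m) ⊑ (g , n) = m ℕ.≤ n × f ≈[ m ] g

⊑-refl : ∀ {c} → c ⊑ c
⊑-refl = ℕ.≤-refl , λ _ _ → refl

⊑-trans : ∀ {c d e} → c ⊑ d → d ⊑ e → c ⊑ e
⊑-trans (m≤n , f≈g) (n≤o , g≈h) = ℕ.≤-trans m≤n n≤o , ≈-trans f≈g (≈-weaken m≤n g≈h)

∋-⊑ : ∀ {c d Y} → c ⊑ d → d ∋ Y → c ∋ Y
∋-⊑ (m≤n , f≈g) g≈Y = ≈-trans f≈g (≈-weaken m≤n g≈Y)

Forces : Condition → Pred Cantor 0ℓ → Set
Forces c P = ∀ Y → c ∋ Y → P Y

Forces-⊑ : ∀ {c d P} → c ⊑ d → Forces c P → Forces d P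
Forces-⊑ c⊑d forces Y d∋Y = forces Y (∋-⊑ c⊑d d∋Y)

DenselyForced : Pred Cantor 0ℓ → Set
DenselyForced P = ∀ c → ∃[ d ] (c ⊑ d × Forces d P)

-- If `p` decides `R`, this is the complement of the corresponding Π⁰₁ set.
Rejected : Program 1 → Pred Cantor 0ℓ
Rejected p Y = ∃[ k ] Y ⊢ p ⟨ k ∷ [] ⟩⇓ 0

force-ones : ∀ c → ∃[ d ] (c ⊑ d × proj₂ c ℕ.< proj₂ d × Forces d (MostlyOnes (proj₂ d)))
force-ones (f , n) = (pad f n , n ℕ.+ k) , (ℕ.m≤m+n n k , pad-≈ f n) , ℕ.m<m+n n (s≤s z≤n) , ones
  where
  -- The ones must outnumber the old bits three to one; `suc n` keeps the block nonempty when `n` is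
  -- 0.
  k : ℕ
  k = 3 ℕ.* suc n
  ones : Forces (pad f n , n ℕ.+ k) (MostlyOnes (n ℕ.+ k))
  ones Y Y≈ = begin
    -- Rounding `n` up to `suc n` turns the total length into four times `suc n`.
    3 ℕ.* (n ℕ.+ k)                                  ≤⟨ ℕ.*-monoʳ-≤ 3 (ℕ.+-monoˡ-≤ k (ℕ.n≤1+n n)) ⟩
    3 ℕ.* (4 ℕ.* suc n)                              ≡⟨ ℕ.*-assoc 3 4 (suc n) ⟨
    12 ℕ.* suc n                                     ≡⟨ ℕ.*-assoc 4 3 (suc n) ⟩
    4 ℕ.* k                                          ≤⟨ ℕ.*-monoʳ-≤ 4 (sum-ones n k λ i i<k →
                                                          trans (sym (Y≈ (n ℕ.+ i) (ℕ.+-monoʳ-< n i<k))) (pad-ones f n i)) ⟩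
    4 ℕ.* sum (applyUpTo (toℕ ∘ Y) (n ℕ.+ k))        ∎
    where open ℕ.≤-Reasoning

-- The generic point

module Generic (em : ExcludedMiddle 0ℓ) where

  rejection-dense : ∀ {A : Pred Cantor 0ℓ} {R : Cantor → ℕ → Set} {p} →
    (∀ X n → (R X n × X ⊢ p ⟨ n ∷ [] ⟩⇓ 1) ⊎ (¬ R X n × X ⊢ p ⟨ n ∷ [] ⟩⇓ 0)) →
    (∀ X → (∀ n → R X n) → A X) → μ⟨ A ⟩≡ 0ℚ → DenselyForced (Rejected p)
  rejection-dense {A} {R} {p} decides R⊆A null (f , n) =
    extend (null-misses em null f n)
    where
    extend : ∃[ Y ] (f ≈[ n ] Y × ¬ A Y) → ∃[ d ] ((f , n) ⊑ d × Forces d (Rejected p))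
    -- `Y` lies outside `A`, so acceptance of every input is impossible; excluded middle then
    -- provides a rejected input.
    extend (Y , f≈Y , Y∉A) with em {Rejected p Y}
    ... | no ¬rejected = ⊥-elim (Y∉A (R⊆A Y accepted))
      where
      accepted : ∀ k → R Y k
      accepted k with decides Y k
      ... | inj₁ (r , _) = r
      ... | inj₂ (_ , d) = ⊥-elim (¬rejected (k , d))
    ... | yes (k , d) =
      let m , use = use-principle d in
      -- The maximum preserves both the old condition and the bits used by the computation.
      (Y , n ⊔ m) , (ℕ.m≤m⊔n n m , f≈Y) ,
      λ Z Y≈Z → k , use Z (≈-weaken (ℕ.m≤n⊔m n m) Y≈Z)

  -- Density may fail for an arbitrary program, so it appears as a premise of the outcome only. The
  -- choice depends on whether `c` itself has a forcing extension; if it has none, density is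
  -- refuted at `c`.
  force : ∀ P c → ∃[ d ] (c ⊑ d × (DenselyForced P → Forces d P))
  force P c with em {∃[ d ] (c ⊑ d × Forces d P)}
  ... | yes (d , c⊑d , forces) = d , c⊑d , λ _ → forces
  ... | no ¬forced             = c , ⊑-refl , λ dense → ⊥-elim (¬forced (dense c))

  force-all : ∀ ps c → ∃[ d ] (c ⊑ d ×
    (∀ {p} → p ∈ ps → DenselyForced (Rejected p) → Forces d (Rejected p)))
  force-all []       c = c , ⊑-refl , λ ()
  force-all (p ∷ ps) c
    with d , c⊑d , forces  ← force (Rejected p) c
    with e , d⊑e , forces′ ← force-all ps d
    = e , ⊑-trans c⊑d d⊑e , λ
      { (here refl) dense → Forces-⊑ {P = Rejected p} d⊑e (forces dense)
      ; (there p∈)  dense → forces′ p∈ dense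
      }

  step : ∀ s c → ∃[ d ] (c ⊑ d × proj₂ c ℕ.< proj₂ d × Forces d (MostlyOnes (proj₂ d)) ×
    (∀ {p} → p ∈ programs s 1 → DenselyForced (Rejected p) → Forces d (Rejected p)))
  step s c
    with d , c⊑d , forces ← force-all (programs s 1) c
    -- The ones come last, so the high average occurs exactly at the length of the new condition;
    -- forced rejections survive the extension.
    with e , d⊑e , d<e , ones ← force-ones d
    = e , ⊑-trans c⊑d d⊑e , ℕ.≤-<-trans (proj₁ c⊑d) d<e , ones ,
      λ {p} p∈ dense → Forces-⊑ {P = Rejected p} d⊑e (forces p∈ dense)

  chain : ℕ → Condition
  chain zero    = (λ _ → zero) , 0
  chain (suc s) = proj₁ (step s (chain s))

  chain-mono : ∀ {s t} → s ℕ.≤′ t → chain s ⊑ chain t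
  chain-mono ℕ.≤′-refl           = ⊑-refl
  chain-mono (ℕ.≤′-step {t} s≤t) = ⊑-trans (chain-mono s≤t) (proj₁ (proj₂ (step t (chain t))))

  chain-length : ∀ s → s ℕ.≤ proj₂ (chain s)
  chain-length zero    = z≤n
  chain-length (suc s) = ℕ.≤-<-trans (chain-length s) (proj₁ (proj₂ (proj₂ (step s (chain s)))))

  -- Bit `i` is read from condition `suc i`, which by `chain-length` is long enough to fix it.
  generic : Cantor
  generic i = proj₁ (chain (suc i)) i

  -- Of `chain s` and the condition that supplies bit `i`, the later extends the earlier, and both
  -- are long enough to determine that bit.
  chain∋generic : ∀ s → chain s ∋ generic
  chain∋generic s i i<s with ℕ.≤-total s (suc i)
  ... | inj₁ le = proj₂ (chain-mono (ℕ.≤⇒≤′ le)) i i<s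
  ... | inj₂ le = sym (proj₂ (chain-mono (ℕ.≤⇒≤′ le)) i (chain-length (suc i)))

  generic-mostlyOnes : ∀ s → MostlyOnes (proj₂ (chain (suc s))) generic
  generic-mostlyOnes s =
    proj₁ (proj₂ (proj₂ (proj₂ (step s (chain s))))) generic (chain∋generic (suc s))

  generic-rejected : ∀ p → DenselyForced (Rejected p) → Rejected p generic
  generic-rejected p dense =
    let s , p∈ = programs-complete p in
    proj₂ (proj₂ (proj₂ (proj₂ (step s (chain s))))) (p∈ ℕ.≤-refl) dense
      generic (chain∋generic (suc s))

  generic-weaklyRandom : WeaklyRandom generic
  generic-weaklyRandom A (R , (p , decides) , A⇔R) null X∈A =
    -- Rejection by the deciding program would contradict either determinism or membership in `A`.
    unrejected (generic-rejected p
      (rejection-dense decides (λ X → Equivalence.from (A⇔R X)) null))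
    where
    unrejected : ¬ Rejected p generic
    unrejected (k , d) with decides generic k
    ... | inj₁ (_ , d′) = case deterministic d d′ of λ ()
    ... | inj₂ (¬r , _) = ¬r (Equivalence.to (A⇔R generic) X∈A k)

  generic-¬SLLN : ¬ ObeysSLLN generic
  generic-¬SLLN = often-mostlyOnes⇒¬SLLN λ m →
    proj₂ (chain (suc m)) , chain-length (suc m) , generic-mostlyOnes m

lemma3p1 : ExcludedMiddle 0ℓ → ∃[ X ] (WeaklyRandom X × ¬ ObeysSLLN X)
lemma3p1 em = generic , generic-weaklyRandom , generic-¬SLLN
  where open Generic em
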